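{- Let $\mathcal{C}$ be a complete category and $(F,G)$ a constructor specification on $\mathcal{C}$. For an object $X$ of the category of algebras $\mathrm{Alg}_{\mathcal{C}}(F,G)$, the type expressing that $X$ is initial is equivalent to the type expressing that $X$ is section inductive.
   Context: Work in Martin-Löf type theory with function extensionality; $\mathsf{Set}$ is the universe/category of sets (types satisfying UIP). For $F : \mathcal{C} \Rightarrow \mathsf{Set}$, $\int_{\mathcal{C}} F$ is the category of elements (objects $(X,x)$ with $x : FX$, morphisms $f$ with $F(f)\,x = y$). A functor $\mathcal{D} \Rightarrow \mathsf{Set}$ is continuous relative to $U : \mathcal{D} \Rightarrow \mathcal{D}_0$ ($\mathcal{D}_0$ complete) if it maps cones over small diagrams that $U$ sends to limit cones to limit cones in $\mathsf{Set}$. A constructor specification on complete $\mathcal{C}$ is a pair $(F,G)$ with $F : \mathcal{C} \Rightarrow \mathsf{Set}$ and $G : \int_{\mathcal{C}} F \Rightarrow \mathsf{Set}$ continuous relative to the forgetful functor to $\mathcal{C}$. $\mathrm{Alg}_{\mathcal{C}}(F,G)$ has objects $(X,\theta)$ with $\theta : (x : FX) \to G(X,x)$ and morphisms $f : X \to Y$ in $\mathcal{C}$ with $\psi(F(f)\,x) = G(\overline{f})(\theta\,x)$ for all $x : FX$, where $\overline f : (X,x) \to (Y,F(f)\,x)$. An object $X$ is initial if for every $Y$ the set of morphisms $X \to Y$ is contractible; it is section inductive if for every $p : Y \to X$ there exists $s : X \to Y$ with $p \circ s = \mathrm{id}_X$ (as a type: $\prod_{Y}\prod_{p : Y \to X}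 \sum_{s : X \to Y} (p \circ s = \mathrm{id}_X)$). -}

{-# OPTIONS --without-K --safe #-}

module Defs where

open import Level using (Level; _⊔_; Setω) renaming (suc to lsuc)
open import Axiom.Extensionality.Propositional using (Extensionality)
open import Axiom.UniquenessOfIdentityProofs using (UIP; module Constant⇒UIP)
open import Data.Product.Base using (Σ; Σ-syntax; _,_; proj₁; proj₂)
open import Relation.Binary.PropositionalEquality using (_≡_; refl; sym; trans; cong; cong-app; module ≡-Reasoning)

FunExt : Setω
FunExt = ∀ {a b} → Extensionality a b

IsProp : ∀ {a} → Set a → Set a
IsProp A = (x y : A) → x ≡ y

IsContr : ∀ {a} → Set a → Set a
IsContr A = Σ[ c ∈ A ] (∀ x → c ≡ x)

Σ-≡ : ∀ {a b} {A : Set a} {B : A → Set b} → (∀ x → IsProp (B x)) →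
      {u v : Σ A B} → proj₁ u ≡ proj₁ v → u ≡ v
Σ-≡ B-prop {x , b} {.x , c} refl = cong (x ,_) (B-prop x b c)

Σ-UIP : ∀ {a b} {A : Set a} {B : A → Set b} →
        UIP A → (∀ x → IsProp (B x)) → UIP (Σ A B)
Σ-UIP A-set B-prop = Constant⇒UIP.≡-irrelevant
  (λ e → Σ-≡ B-prop (cong proj₁ e))
  (λ p q → cong (Σ-≡ B-prop) (A-set (cong proj₁ p) (cong proj₁ q)))

Π-UIP : FunExt → ∀ {a b} {A : Set a} {B : A → Set b} →
        (∀ x → UIP (B x)) → UIP ((x : A) → B x)
Π-UIP ext B-set = Constant⇒UIP.≡-irrelevant
  (λ e → ext (cong-app e))
  (λ p q → cong ext (ext (λ x → B-set x (cong-app p x) (cong-app q x))))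

record HSet (ℓ : Level) : Set (lsuc ℓ) where
  constructor hset
  field
    ∣_∣   : Set ℓ
    isSet : UIP ∣_∣

open HSet public

record Category (o h : Level) : Set (lsuc (o ⊔ h)) where
  infixr 9 _∘_
  field
    Obj       : Set o
    Hom       : Obj → Obj → Set h
    Hom-set   : ∀ {X Y} → UIP (Hom X Y)
    id        : ∀ {X} → Hom X X
    _∘_       : ∀ {X Y Z} → Hom Y Z → Hom X Y → Hom X Z
    identityˡ : ∀ {X Y} (f : Hom X Y) → id ∘ f ≡ f
    identityʳ : ∀ {X Y} (f : Hom X Y) → f ∘ id ≡ f
    assoc     : ∀ {W X Y Z} (f : Hom W X) (g : Hom X Y) (k : Hom Y Z) →
                (k ∘ g) ∘ f ≡ k ∘ (g ∘ f)

record Functor {o h o′ h′} (C : Category o h) (D : Category o′ h′) :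
               Set (o ⊔ h ⊔ o′ ⊔ h′) where
  private
    module C = Category C
    module D = Category D
  field
    F₀           : C.Obj → D.Obj
    F₁           : ∀ {X Y} → C.Hom X Y → D.Hom (F₀ X) (F₀ Y)
    identity     : ∀ {X} → F₁ (C.id {X}) ≡ D.id
    homomorphism : ∀ {X Y Z} (f : C.Hom X Y) (g : C.Hom Y Z) →
                   F₁ (g C.∘ f) ≡ F₁ g D.∘ F₁ f

infixr 9 _∘F_
_∘F_ : ∀ {o h o′ h′ o″ h″} {C : Category o h} {D : Category o′ h′} {E : Category o″ h″} →
       Functor D E → Functor C D → Functor C E
G ∘F F = record
  { F₀           = λ X → G.F₀ (F.F₀ X)
  ; F₁           = λ f → G.F₁ (F.F₁ f)
  ; identity     = trans (cong G.F₁ F.identity) G.identity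
  ; homomorphism = λ f g → trans (cong G.F₁ (F.homomorphism f g)) (G.homomorphism (F.F₁ f) (F.F₁ g))
  }
  where
    module F = Functor F
    module G = Functor G

module _ {o h} (C : Category o h) where
  open Category C

  IsInitial : Obj → Set (o ⊔ h)
  IsInitial X = ∀ Y → IsContr (Hom X Y)

  IsSectionInductive : Obj → Set (o ⊔ h)
  IsSectionInductive X = ∀ Y (p : Hom Y X) → Σ[ s ∈ Hom X Y ] (p ∘ s ≡ id)

record Cone {o h o′ h′} {J : Category o′ h′} {C : Category o h} (D : Functor J C) :
            Set (o ⊔ h ⊔ o′ ⊔ h′) where
  private
    module J = Category J
    module D = Functor D
  open Category C
  field
    apex    : Obj
    leg     : ∀ j → Hom apex (D.F₀ j)
    commute : ∀ {i j} (u : J.Hom i j) → D.F₁ u ∘ leg i ≡ leg j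

IsLimit : ∀ {o h o′ h′} {J : Category o′ h′} {C : Category o h} {D : Functor J C} →
          Cone D → Set (o ⊔ h ⊔ o′ ⊔ h′)
IsLimit {C = C} {D = D} L =
  (K : Cone D) → IsContr (Σ[ u ∈ Hom (Cone.apex K) (Cone.apex L) ]
                          (∀ j → Cone.leg L j ∘ u ≡ Cone.leg K j))
  where open Category C

mapCone : ∀ {o h o′ h′ o″ h″} {J : Category o″ h″} {C : Category o h} {E : Category o′ h′}
          (U : Functor C E) {D : Functor J C} → Cone D → Cone (U ∘F D)
mapCone U {D} K = record
  { apex    = U.F₀ K.apex
  ; leg     = λ j → U.F₁ (K.leg j)
  ; commute = λ u → trans (sym (U.homomorphism (K.leg _) (D.F₁ u))) (cong U.F₁ (K.commute u))
  }
  where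
    module U = Functor U
    module D = Functor D
    module K = Cone K

-- "Small" means of level ℓ, the level of the sets in the category SET below.
-- There is no truncation: completeness provides a chosen limit cone.
Complete : ∀ {o h} (ℓ : Level) → Category o h → Set (o ⊔ h ⊔ lsuc ℓ)
Complete ℓ C = (J : Category ℓ ℓ) (D : Functor J C) → Σ (Cone D) IsLimit

module WithFunExt (ext : FunExt) where

  SET : (ℓ : Level) → Category (lsuc ℓ) ℓ
  SET ℓ = record
    { Obj       = HSet ℓ
    ; Hom       = λ A B → ∣ A ∣ → ∣ B ∣
    ; Hom-set   = λ {_} {B} → Π-UIP ext (λ _ → isSet B)
    ; id        = λ x → x
    ; _∘_       = λ g f x → g (f x)
    ; identityˡ = λ _ → refl
    ; identityʳ = λ _ → refl
    ; assoc     = λ _ _ _ → refl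
    }

  RelativelyContinuous : ∀ {o h o′ h′ ℓ} {D : Category o h} {D₀ : Category o′ h′} →
                         Functor D D₀ → Functor D (SET ℓ) → Set (o ⊔ h ⊔ o′ ⊔ h′ ⊔ lsuc ℓ)
  RelativelyContinuous {ℓ = ℓ} {D = D} U G =
    (J : Category ℓ ℓ) (Δ : Functor J D) (K : Cone Δ) →
    IsLimit (mapCone U K) → IsLimit (mapCone G K)

  module _ {o h ℓ} {C : Category o h} (F : Functor C (SET ℓ)) where
    private
      module C = Category C
      module F = Functor F

    ∫Obj : Set (o ⊔ ℓ)
    ∫Obj = Σ[ X ∈ C.Obj ] ∣ F.F₀ X ∣

    ∫Hom : ∫Obj → ∫Obj → Set (h ⊔ ℓ)
    ∫Hom (X , x) (Y , y) = Σ[ f ∈ C.Hom X Y ] (F.F₁ f x ≡ y)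

    ∫Hom-≡ : ∀ {A B} {f g : ∫Hom A B} → proj₁ f ≡ proj₁ g → f ≡ g
    ∫Hom-≡ {B = Y , _} = Σ-≡ (λ _ → isSet (F.F₀ Y))

    ∫ : Category (o ⊔ ℓ) (h ⊔ ℓ)
    ∫ = record
      { Obj       = ∫Obj
      ; Hom       = ∫Hom
      ; Hom-set   = λ { {_} {Y , _} → Σ-UIP C.Hom-set (λ _ → isSet (F.F₀ Y)) }
      ; id        = C.id , cong-app F.identity _
      ; _∘_       = λ { (g , q) (f , p) →
                      g C.∘ f , trans (cong-app (F.homomorphism f g) _) (trans (cong (F.F₁ g) p) q) }
      ; identityˡ = λ f → ∫Hom-≡ (C.identityˡ (proj₁ f))
      ; identityʳ = λ f → ∫Hom-≡ (C.identityʳ (proj₁ f))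
      ; assoc     = λ f g k → ∫Hom-≡ (C.assoc (proj₁ f) (proj₁ g) (proj₁ k))
      }

    forget : Functor ∫ C
    forget = record
      { F₀           = proj₁
      ; F₁           = proj₁
      ; identity     = refl
      ; homomorphism = λ _ _ → refl
      }

    lift : ∀ {X Y} (f : C.Hom X Y) (x : ∣ F.F₀ X ∣) → ∫Hom (X , x) (Y , F.F₁ f x)
    lift f x = f , refl

  record ConstructorSpec {o h} (ℓ : Level) (C : Category o h) : Set (o ⊔ h ⊔ lsuc ℓ) where
    field
      F            : Functor C (SET ℓ)
      G            : Functor (∫ F) (SET ℓ)
      G-continuous : RelativelyContinuous (forget F) G

  module _ {o h ℓ} {C : Category o h} (S : ConstructorSpec ℓ C) where
    open ConstructorSpec S using (F; G)
    private
      module C  = Category C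
      module F  = Functor F
      module G  = Functor G
      module ∫F = Category (∫ F)

    AlgObj : Set (o ⊔ ℓ)
    AlgObj = Σ[ X ∈ C.Obj ] ((x : ∣ F.F₀ X ∣) → ∣ G.F₀ (X , x) ∣)

    IsAlgHom : ((X , _) (Y , _) : AlgObj) → C.Hom X Y → Set ℓ
    IsAlgHom (X , θ) (Y , ψ) f = ∀ x → ψ (F.F₁ f x) ≡ G.F₁ (lift F f x) (θ x)

    IsAlgHom-prop : ∀ A B f → IsProp (IsAlgHom A B f)
    IsAlgHom-prop A B f p q = ext (λ x → isSet (G.F₀ _) (p x) (q x))

    AlgHom : AlgObj → AlgObj → Set (h ⊔ ℓ)
    AlgHom A B = Σ (C.Hom (proj₁ A) (proj₁ B)) (IsAlgHom A B)

    AlgHom-≡ : ∀ {A B} {f g : AlgHom A B} → proj₁ f ≡ proj₁ g → f ≡ g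
    AlgHom-≡ {A} {B} = Σ-≡ (IsAlgHom-prop A B)

    IsAlgHom-along : ∀ {A B f} → IsAlgHom A B f →
                     ∀ {x y} (p : F.F₁ f x ≡ y) → proj₂ B y ≡ G.F₁ (f , p) (proj₂ A x)
    IsAlgHom-along f-hom refl = f-hom _

    id-isAlgHom : ∀ A → IsAlgHom A A C.id
    id-isAlgHom (X , θ) x = along (sym (cong-app F.identity x)) refl
      where
        along : ∀ {y} → x ≡ y → (q : F.F₁ C.id x ≡ y) → θ y ≡ G.F₁ (C.id , q) (θ x)
        along refl q = sym (trans
          (cong (λ f → G.F₁ f (θ x)) (∫Hom-≡ F {f = C.id , q} {g = ∫F.id} refl))
          (cong-app G.identity (θ x)))

    ∘-isAlgHom : ∀ {A₁ A₂ A₃ g f} → IsAlgHom A₂ A₃ g → IsAlgHom A₁ A₂ f → IsAlgHom A₁ A₃ (g C.∘ f)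
    ∘-isAlgHom {X , θ} {Y , ψ} {Z , ξ} {g} {f} g-hom f-hom x = begin
      ξ (F.F₁ (g C.∘ f) x)                   ≡⟨ IsAlgHom-along {Y , ψ} {Z , ξ} g-hom q ⟩
      G.F₁ (g , q) (ψ (F.F₁ f x))            ≡⟨ cong (G.F₁ (g , q)) (f-hom x) ⟩
      G.F₁ (g , q) (G.F₁ (lift F f x) (θ x)) ≡⟨ cong-app (G.homomorphism (lift F f x) (g , q)) (θ x) ⟨
      G.F₁ ((g , q) ∫F.∘ lift F f x) (θ x)   ≡⟨ cong (λ k → G.F₁ k (θ x)) (∫Hom-≡ F refl) ⟩
      G.F₁ (lift F (g C.∘ f) x) (θ x)        ∎
      where
        open ≡-Reasoning
        q : F.F₁ g (F.F₁ f x) ≡ F.F₁ (g C.∘ f) x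
        q = sym (cong-app (F.homomorphism f g) x)

    Alg : Category (o ⊔ ℓ) (h ⊔ ℓ)
    Alg = record
      { Obj       = AlgObj
      ; Hom       = AlgHom
      ; Hom-set   = λ {A} {B} → Σ-UIP C.Hom-set (IsAlgHom-prop A B)
      ; id        = λ {A} → C.id , id-isAlgHom A
      ; _∘_       = λ {A₁} {A₂} {A₃} (g , g-hom) (f , f-hom) →
                      g C.∘ f , ∘-isAlgHom {A₁} {A₂} {A₃} g-hom f-hom
      ; identityˡ = λ {A} {B} f → AlgHom-≡ {A} {B} (C.identityˡ (proj₁ f))
      ; identityʳ = λ {A} {B} f → AlgHom-≡ {A} {B} (C.identityʳ (proj₁ f))
      ; assoc     = λ {A₁} {_} {_} {A₄} f g k →
                      AlgHom-≡ {A₁} {A₄} (C.assoc (proj₁ f) (proj₁ g) (proj₁ k))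
      }

{-# OPTIONS --safe #-}
{-# OPTIONS --without-K #-}

-- In any category with all small cones, a section inductive X is initial: take
-- a cone over the diagram consisting of X, Y and all morphisms X → Y. Its legs
-- e : E → X and d : E → Y satisfy f ∘ e ≡ d for every f : X → Y, so for a
-- section s of e every f equals f ∘ e ∘ s ≡ d ∘ s. The category of algebras has
-- small cones because the limit L of the underlying diagram in C carries an
-- algebra structure: for x : F L, continuity of G presents G (L , x) as the
-- limit of the sets G (D j , F (leg j) x), in which the structure maps of the
-- algebras D j give a compatible family of points.
module Submission where

open import Defs
open import Level using (Level)
open import Axiom.UniquenessOfIdentityProofs using (UIP; module Constant⇒UIP)
open import Data.Empty.Polymorphic using (⊥)
open import Data.Product.Base using (Σ-syntax; _,_; proj₁; proj₂)
open import Data.Unit.Polymorphic using (⊤; tt)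
open import Function.Bundles using (mk↔ₛ′)
open import Function.Properties.Inverse.HalfAdjointEquivalence using (_≃_; ↔⇒≃)
open import Relation.Binary.PropositionalEquality using (_≡_; refl; sym; trans; cong; cong-app; module ≡-Reasoning)

IsProp⇒≃ : ∀ {a b} {A : Set a} {B : Set b} → IsProp A → IsProp B →
           (A → B) → (B → A) → A ≃ B
IsProp⇒≃ A-prop B-prop to from =
  ↔⇒≃ (mk↔ₛ′ to from (λ _ → B-prop _ _) (λ _ → A-prop _ _))

IsContr⇒IsProp : ∀ {a} {A : Set a} → IsContr A → IsProp A
IsContr⇒IsProp (_ , c≡) x y = trans (sym (c≡ x)) (c≡ y)

-- Lets the propositionality of section inductivity be proved under the assumption that it holds,
-- where initiality is already available.
inhabited-IsProp : ∀ {a} {A : Set a} → (A → IsProp A) → IsProp A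
inhabited-IsProp A-prop x = A-prop x x

IsContr-isProp : FunExt → ∀ {a} {A : Set a} → UIP A → IsProp (IsContr A)
IsContr-isProp ext A-set (c , c≡) (d , _) =
  Σ-≡ (λ _ p q → ext (λ x → A-set (p x) (q x))) (c≡ d)

⊤-UIP : ∀ {ℓ} → UIP (⊤ {ℓ})
⊤-UIP = Constant⇒UIP.≡-irrelevant (λ _ → refl) (λ _ _ → refl)

data Endpoint {ℓ : Level} : Set ℓ where
  source target : Endpoint

module _ {ℓ} {A : Set ℓ} (A-set : UIP A) where

  ParallelHom : Endpoint {ℓ} → Endpoint {ℓ} → Set ℓ
  ParallelHom source source = ⊤
  ParallelHom source target = A
  ParallelHom target source = ⊥
  ParallelHom target target = ⊤

  -- A cone over a diagram of this shape is a fork: a morphism on which all the `A`-indexed parallel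
  -- arrows agree.
  ParallelArrows : Category ℓ ℓ
  ParallelArrows = record
    { Obj       = Endpoint
    ; Hom       = ParallelHom
    ; Hom-set   = λ {i} {j} → hom-set i j
    ; id        = λ {i} → id′ i
    ; _∘_       = λ {i} {j} {k} → comp i j k
    ; identityˡ = λ {i} {j} → idˡ i j
    ; identityʳ = λ {i} {j} → idʳ i j
    ; assoc     = λ {i} {j} {k} {l} → comp-assoc i j k l
    }
    where
      hom-set : ∀ i j → UIP (ParallelHom i j)
      hom-set source source = ⊤-UIP
      hom-set source target = A-set
      hom-set target source {()}
      hom-set target target = ⊤-UIP

      id′ : ∀ i → ParallelHom i i
      id′ source = tt
      id′ target = tt

      comp : ∀ i j k → ParallelHom j k → ParallelHom i j → ParallelHom i k
      comp source source k      g _ = g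
      comp source target target _ f = f
      comp target target k      g _ = g

      idˡ : ∀ i j (f : ParallelHom i j) → comp i j j (id′ j) f ≡ f
      idˡ source source _ = refl
      idˡ source target _ = refl
      idˡ target target _ = refl

      idʳ : ∀ i j (f : ParallelHom i j) → comp i i j f (id′ i) ≡ f
      idʳ source j _ = refl
      idʳ target j _ = refl

      comp-assoc : ∀ i j k l (f : ParallelHom i j) (g : ParallelHom j k) (h : ParallelHom k l) →
                   comp i j l (comp j k l h g) f ≡ comp i k l h (comp i j k g f)
      comp-assoc source source k      l      _ _ _ = refl
      comp-assoc source target target target _ _ _ = refl
      comp-assoc target target k      l      _ _ _ = refl

  parallelDiagram : ∀ {o h} (C : Category o h) {X Y : Category.Obj C} →
                    (A → Category.Hom C X Y) → Functor ParallelArrows C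
  parallelDiagram C {X} {Y} arrow = record
    { F₀           = obj
    ; F₁           = λ {i} {j} → hom i j
    ; identity     = λ {i} → hom-id i
    ; homomorphism = λ {i} {j} {k} → hom-∘ i j k
    }
    where
      open Category C
      module P = Category ParallelArrows

      obj : Endpoint → Obj
      obj source = X
      obj target = Y

      hom : ∀ i j → ParallelHom i j → Hom (obj i) (obj j)
      hom source source _ = id
      hom source target a = arrow a
      hom target target _ = id

      hom-id : ∀ i → hom i i (P.id {i}) ≡ id
      hom-id source = refl
      hom-id target = refl

      hom-∘ : ∀ i j k (f : ParallelHom i j) (g : ParallelHom j k) →
              hom i k (P._∘_ {i} {j} {k} g f) ≡ hom j k g ∘ hom i j f
      hom-∘ source source k      _ g = sym (identityʳ _)
      hom-∘ source target target _ _ = sym (identityˡ _)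
      hom-∘ target target k      _ g = sym (identityʳ _)

-- Bare cones, chosen rather than merely existing: the initiality argument uses only the equations
-- between legs.
HasCones : ∀ {o h} (ℓ : Level) → Category o h → Set _
HasCones ℓ C = (J : Category ℓ ℓ) (D : Functor J C) → Cone D

module _ {o h} (C : Category o h) where
  open Category C

  IsInitial-isProp : FunExt → ∀ X → IsProp (IsInitial C X)
  IsInitial-isProp ext X p q = ext (λ Y → IsContr-isProp ext Hom-set (p Y) (q Y))

  initial⇒sectionInductive : ∀ {X} → IsInitial C X → IsSectionInductive C X
  initial⇒sectionInductive {X} X-init Y p =
    -- `p ∘ s` and `id` are both endomorphisms of the initial object `X`.
    proj₁ (X-init Y) , IsContr⇒IsProp (X-init X) _ _

  -- Two sections of `p` are morphisms out of an initial object, hence equal; `Hom-set` identifies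
  -- the section equations.
  initial⇒sectionInductive-isProp : FunExt → ∀ {X} → IsInitial C X →
                                    IsProp (IsSectionInductive C X)
  initial⇒sectionInductive-isProp ext X-init u v = ext (λ Y → ext (λ p →
    Σ-≡ (λ _ → Hom-set) (IsContr⇒IsProp (X-init Y) _ _)))

  sectionInductive⇒initial : HasCones h C → ∀ {X} → IsSectionInductive C X → IsInitial C X
  sectionInductive⇒initial cones {X} X-ind Y = leg target ∘ s , unique
    where
      -- The hom-set `Hom X Y` indexes its own arrows, so the diagram is small at the level `h` of
      -- the homs.
      open Cone (cones (ParallelArrows Hom-set) (parallelDiagram Hom-set C (λ (f : Hom X Y) → f)))
      open ≡-Reasoning

      s : Hom X apex
      s = proj₁ (X-ind apex (leg source))

      unique : ∀ f → leg target ∘ s ≡ f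
      unique f = begin
        leg target ∘ s       ≡⟨ cong (_∘ s) (commute {source} {target} f) ⟨
        (f ∘ leg source) ∘ s ≡⟨ assoc s (leg source) f ⟩
        f ∘ (leg source ∘ s) ≡⟨ cong (f ∘_) (proj₂ (X-ind apex (leg source))) ⟩
        f ∘ id               ≡⟨ identityʳ f ⟩
        f                    ∎

module _ (ext : FunExt) where
  open WithFunExt ext

  -- A compatible family is a cone with a one-point apex; the mediating map sends `tt` to the
  -- required point.
  limit-point : ∀ {ℓ o h} {J : Category o h} {D : Functor J (SET ℓ)} (L : Cone D) → IsLimit L →
                (d : ∀ j → ∣ Functor.F₀ D j ∣) →
                (∀ {i j} (u : Category.Hom J i j) → Functor.F₁ D u (d i) ≡ d j) →
                Σ[ x ∈ ∣ Cone.apex L ∣ ] (∀ j → Cone.leg L j x ≡ d j)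
  limit-point {D = D} L L-lim d d-compat = proj₁ u tt , λ j → cong-app (proj₂ u j) tt
    where
      point : Cone D
      point = record
        { apex    = hset ⊤ ⊤-UIP
        ; leg     = λ j _ → d j
        ; commute = λ u → cong (λ y _ → y) (d-compat u)
        }

      u = proj₁ (L-lim point)

  module _ {o ℓ} {C : Category o ℓ} (S : ConstructorSpec ℓ C) where
    open ConstructorSpec S
    private
      module C = Category C
      module F = Functor F
      module G = Functor G

    forgetAlg : Functor (Alg S) C
    forgetAlg = record
      { F₀           = proj₁
      ; F₁           = proj₁
      ; identity     = refl
      ; homomorphism = λ _ _ → refl
      }

    module _ {J : Category ℓ ℓ} (D : Functor J (Alg S))
             (L : Cone (forgetAlg ∘F D)) (L-lim : IsLimit L) where
      private
        module J = Category J
        module D = Functor D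
        module L = Cone L

      module _ (x : ∣ F.F₀ L.apex ∣) where

        -- Pushing `x` along the legs of `L` lifts the underlying diagram from `C` to `∫ F`;
        -- `L.commute` makes the chosen elements match.
        elementDiagram : Functor J (∫ F)
        elementDiagram = record
          { F₀           = λ j → proj₁ (D.F₀ j) , F.F₁ (L.leg j) x
          ; F₁           = λ {i} u → proj₁ (D.F₁ u) ,
              trans (sym (cong-app (F.homomorphism (L.leg i) (proj₁ (D.F₁ u))) x))
                    (cong (λ f → F.F₁ f x) (L.commute u))
          ; identity     = ∫Hom-≡ F (cong proj₁ D.identity)
          ; homomorphism = λ u v → ∫Hom-≡ F (cong proj₁ (D.homomorphism u v))
          }

        elementCone : Cone elementDiagram
        elementCone = record
          { apex    = L.apex , x
          ; leg     = λ j → lift F (L.leg j) x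
          ; commute = λ u → ∫Hom-≡ F (L.commute u)
          }

        -- forget ∘F elementDiagram and forgetAlg ∘F D differ only in their proofs
        -- of the functor laws, so a cone over one is repackaged as a cone over the other.
        elementCone-isLimit : IsLimit (mapCone (forget F) elementCone)
        elementCone-isLimit K = L-lim (record
          { apex = Cone.apex K ; leg = Cone.leg K ; commute = Cone.commute K })

        -- The second component, read backwards, says that each leg of `L` is an algebra morphism.
        limitStructure : Σ[ y ∈ ∣ G.F₀ (L.apex , x) ∣ ]
                         (∀ j → G.F₁ (lift F (L.leg j) x) y ≡ proj₂ (D.F₀ j) (F.F₁ (L.leg j) x))
        limitStructure = limit-point (mapCone G elementCone)
          (G-continuous J elementDiagram elementCone elementCone-isLimit)
          (λ j → proj₂ (D.F₀ j) (F.F₁ (L.leg j) x))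
          -- The element over `j` equals the image of the one over `i` only propositionally, so the
          -- morphism law of `D.F₁ u` is used along that equation.
          (λ {i} {j} u → sym (IsAlgHom-along S {D.F₀ i} {D.F₀ j} (proj₂ (D.F₁ u)) _))

      algCone : Cone D
      algCone = record
        { apex    = L.apex , λ x → proj₁ (limitStructure x)
        ; leg     = λ j → L.leg j , λ x → sym (proj₂ (limitStructure x) j)
        ; commute = λ {_} {j} u → AlgHom-≡ S {B = D.F₀ j} (L.commute u)
        }

    -- The homs of `C` lie at level `ℓ`, hence so do those of `Alg S`, and these cones cover
    -- diagrams indexed by its hom-sets.
    Alg-hasCones : Complete ℓ C → HasCones ℓ (Alg S)
    Alg-hasCones complete J D = algCone D (proj₁ lim) (proj₂ lim)
      where lim = complete J (forgetAlg ∘F D)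

mainTheorem10 : (ext : FunExt) (let open WithFunExt ext) {o ℓ : Level} (C : Category o ℓ) → Complete ℓ C →
    (S : ConstructorSpec ℓ C) (X : Category.Obj (Alg S)) →
    IsInitial (Alg S) X ≃ IsSectionInductive (Alg S) X
mainTheorem10 ext C complete S X = IsProp⇒≃
  (IsInitial-isProp Alg′ ext X)
  (inhabited-IsProp (λ X-ind → initial⇒sectionInductive-isProp Alg′ ext (toInitial X-ind)))
  (initial⇒sectionInductive Alg′)
  toInitial
  where
    open WithFunExt ext
    Alg′ = Alg S

    toInitial : IsSectionInductive Alg′ X → IsInitial Alg′ X
    toInitial = sectionInductive⇒initial Alg′ (Alg-hasCones ext S complete)
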